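{- Let $m,n\ge1$ be integers and let $\mathcal B(m,n)$ be their closed exponent box. For $z\in\mathcal B(m,n)$ define $z^\sharp:=mn/z$. Then $z^\sharp\in\mathcal B(m,n)$, $(z^\sharp)^\sharp=z$, $$\log z+\log z^\sharp=\log m+\log n,$$ and $$d(z)\,d(z^\sharp)\ge d(m)\,d(n).$$
   Context: $d(n)$ denotes the number of positive divisors of $n$. For $m=\prod_p p^{a_p}$ and $n=\prod_p p^{b_p}$ (products over all primes, finitely many nonzero exponents), the closed exponent box is $$\mathcal B(m,n)=\Bigl\{\prod_p p^{e_p}:\ \min(a_p,b_p)\le e_p\le\max(a_p,b_p)\text{ for all primes }p\Bigr\}.$$ -}

module Defs where

open import Data.Integer.Base as ℤ using (+_; +[1+_])
import Data.Integer.Properties as ℤ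
open import Data.List.Base using (List; length; filter; map; applyUpTo; upTo)
import Data.List.Relation.Unary.All as All
import Data.List.Relation.Unary.All.Properties as All
open import Data.Nat.Base as ℕ using (ℕ; zero; suc; NonZero)
open import Data.Nat.Divisibility using (_∣?_)
open import Data.Nat.ListAction using (product)
open import Data.Nat.ListAction.Properties using (product≢0)
open import Data.Nat.Primality using (Prime; prime?; prime⇒nonZero)
open import Data.Nat.Primality.Factorisation using (factorise; factors)
import Data.Nat.Properties as ℕ
open import Data.Product.Base using (∃-syntax; _×_; _,_)
open import Data.Rational.Base using (ℚ; mkℚ; 0ℚ; ½; _/_; _+_; _*_; _-_; -_; ∣_∣; _≤_; _<_; *<*; toℚᵘ; fromℚᵘ)
open import Data.Rational.Properties
open import Data.Rational.Solver using (module +-*-Solver)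
import Data.Rational.Unnormalised.Base as ℚᵘ
import Data.Rational.Unnormalised.Properties as ℚᵘ
open import Data.Sum.Base using (inj₁; inj₂)
open import Relation.Binary.PropositionalEquality using (_≡_; refl; sym; trans; cong; cong₂; subst; subst₂)

d : ℕ → ℕ
d n = length (filter (_∣? n) (applyUpTo suc n))

exponent : ℕ → (n : ℕ) → .{{NonZero n}} → ℕ
exponent p n = length (filter (p ℕ.≟_) (factors (factorise n)))

primesUpTo : ℕ → List ℕ
primesUpTo N = filter prime? (upTo (suc N))

infix 4 _≡∏p^_

-- z is the product of p ^ e p over all primes p, where e has finite support
-- on the primes (values of e at non-primes are irrelevant).
_≡∏p^_ : ℕ → (ℕ → ℕ) → Set
z ≡∏p^ e = ∃[ N ] (∀ p → Prime p → N ℕ.< p → e p ≡ 0)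
                × z ≡ product (map (λ p → p ℕ.^ e p) (primesUpTo N))

infix 4 _∈𝓑[_,_]

_∈𝓑[_,_] : ℕ → (m n : ℕ) → .{{NonZero m}} → .{{NonZero n}} → Set
z ∈𝓑[ m , n ] = ∃[ e ] z ≡∏p^ e
  × (∀ p → Prime p → exponent p m ℕ.⊓ exponent p n ℕ.≤ e p
                   × e p ℕ.≤ exponent p m ℕ.⊔ exponent p n)

∈𝓑⇒nonZero : ∀ {z} m n .{{_ : NonZero m}} .{{_ : NonZero n}} → z ∈𝓑[ m , n ] → NonZero z
∈𝓑⇒nonZero m n (e , (N , _ , refl) , _) = product≢0 (All.map⁺ (All.map power≢0 (All.all-filter prime? (upTo (suc N)))))
  where
  power≢0 : ∀ {p} → Prime p → NonZero (p ℕ.^ e p)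
  power≢0 {p} pr = ℕ.m^n≢0 p (e p) {{prime⇒nonZero pr}}

-- Natural-number division, hence truncated: it is the true quotient mn/z
-- only once z is known to divide m * n.
sharp : ∀ m n .{{_ : NonZero m}} .{{_ : NonZero n}} z → z ∈𝓑[ m , n ] → ℕ
sharp m n z z∈𝓑 = (m ℕ.* n) ℕ./ z
  where instance _ = ∈𝓑⇒nonZero m n z∈𝓑

-- The real numbers, as Cauchy sequences of rationals up to _≃_.

record ℝ : Set where
  constructor mkℝ
  field
    seq    : ℕ → ℚ
    cauchy : ∀ ε → 0ℚ < ε → ∃[ N ] ∀ i j → N ℕ.≤ i → N ℕ.≤ j → ∣ seq i - seq j ∣ < ε

open ℝ public

infix 4 _≃_

_≃_ : ℝ → ℝ → Set
x ≃ y = ∀ ε → 0ℚ < ε → ∃[ N ] ∀ i → N ℕ.≤ i → ∣ seq x i - seq y i ∣ < ε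

0<½*ε : ∀ ε → 0ℚ < ε → 0ℚ < ½ * ε
0<½*ε ε 0<ε = subst (_< ½ * ε) (*-zeroʳ ½) (*-monoʳ-<-pos ½ 0<ε)

½*ε+½*ε≡ε : ∀ ε → ½ * ε + ½ * ε ≡ ε
½*ε+½*ε≡ε ε = trans (sym (*-distribʳ-+ ε ½ ½)) (*-identityˡ ε)

infixl 6 _+ᵣ_

_+ᵣ_ : ℝ → ℝ → ℝ
seq (x +ᵣ y) i = seq x i + seq y i
cauchy (x +ᵣ y) ε 0<ε with cauchy x (½ * ε) (0<½*ε ε 0<ε) | cauchy y (½ * ε) (0<½*ε ε 0<ε)
... | M , x-close | N , y-close = M ℕ.⊔ N , λ i j i≥ j≥ → begin-strict
  ∣ (seq x i + seq y i) - (seq x j + seq y j) ∣    ≡⟨ cong ∣_∣ (rearrange (seq x i) (seq y i) (seq x j) (seq y j)) ⟩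
  ∣ (seq x i - seq x j) + (seq y i - seq y j) ∣    ≤⟨ ∣p+q∣≤∣p∣+∣q∣ (seq x i - seq x j) (seq y i - seq y j) ⟩
  ∣ seq x i - seq x j ∣ + ∣ seq y i - seq y j ∣    <⟨ +-mono-<
    (x-close i j (ℕ.≤-trans (ℕ.m≤m⊔n M N) i≥) (ℕ.≤-trans (ℕ.m≤m⊔n M N) j≥))
    (y-close i j (ℕ.≤-trans (ℕ.m≤n⊔m M N) i≥) (ℕ.≤-trans (ℕ.m≤n⊔m M N) j≥)) ⟩
  ½ * ε + ½ * ε                                    ≡⟨ ½*ε+½*ε≡ε ε ⟩
  ε                                                ∎
  where
  open ≤-Reasoning
  rearrange : ∀ a b c e → (a + b) - (c + e) ≡ (a - c) + (b - e)
  rearrange = solve 4 (λ a b c e → (a :+ b) :- (c :+ e) := (a :- c) :+ (b :- e)) refl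
    where open +-*-Solver

1/1+_ : ℕ → ℚ
1/1+ k = + 1 / suc k

harmonic : ℕ → ℚ
harmonic zero    = 0ℚ
harmonic (suc k) = harmonic k + 1/1+ k

-- ∑ 1/k over N < k ≤ nN: the right-endpoint Riemann sum of ∫₁ⁿ dt/t with mesh 1/N.
logSum : ℕ → ℕ → ℚ
logSum n N = harmonic (n ℕ.* N) - harmonic N

-- The sequence logSum n is Cauchy: any two meshes 1/i and 1/j are compared
-- with their common refinement 1/(ij).

mul : ℕ → ℚ → ℚ
mul zero    x = 0ℚ
mul (suc b) x = mul b x + x

mul-1/1+ : ∀ b c → mul b (1/1+ c) ≡ fromℚᵘ (ℚᵘ.mkℚᵘ (+ b) c)
mul-1/1+ zero    c = sym (fromℚᵘ-cong {ℚᵘ.mkℚᵘ (+ 0) c} {ℚᵘ.0ℚᵘ} (ℚᵘ.*≡* refl))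
mul-1/1+ (suc b) c = toℚᵘ-injective (begin
  toℚᵘ (mul b (1/1+ c) + 1/1+ c)                  ≈⟨ toℚᵘ-homo-+ (mul b (1/1+ c)) (1/1+ c) ⟩
  toℚᵘ (mul b (1/1+ c)) ℚᵘ.+ toℚᵘ (1/1+ c)        ≈⟨ ℚᵘ.+-cong
    (ℚᵘ.≃-trans (ℚᵘ.≃-reflexive (cong toℚᵘ (mul-1/1+ b c))) (toℚᵘ-fromℚᵘ (ℚᵘ.mkℚᵘ (+ b) c)))
    (toℚᵘ-fromℚᵘ (ℚᵘ.mkℚᵘ (+ 1) c)) ⟩
  ℚᵘ.mkℚᵘ (+ b) c ℚᵘ.+ ℚᵘ.mkℚᵘ (+ 1) c            ≈⟨ ℚᵘ.*≡* eq ⟩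
  ℚᵘ.mkℚᵘ (+ suc b) c                             ≈⟨ toℚᵘ-fromℚᵘ (ℚᵘ.mkℚᵘ (+ suc b) c) ⟨
  toℚᵘ (fromℚᵘ (ℚᵘ.mkℚᵘ (+ suc b) c))             ∎)
  where
  open import Relation.Binary.Reasoning.Setoid ℚᵘ.≃-setoid
  eq : (+ b ℤ.* + suc c ℤ.+ + 1 ℤ.* + suc c) ℤ.* + suc c ≡ + suc b ℤ.* (+ suc c ℤ.* + suc c)
  eq = trans (cong (ℤ._* + suc c) (trans (sym (ℤ.*-distribʳ-+ (+ suc c) (+ b) (+ 1)))
         (cong (λ x → + x ℤ.* + suc c) (ℕ.+-comm b 1)))) (ℤ.*-assoc (+ suc b) (+ suc c) (+ suc c))

-- j · 1/(j(q+1)) = 1/(q+1) for j = j' + 1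
mul-block : ∀ j' q → mul (suc j') (1/1+ (q ℕ.+ j' ℕ.* suc q)) ≡ 1/1+ q
mul-block j' q = trans (mul-1/1+ (suc j') (q ℕ.+ j' ℕ.* suc q))
  (fromℚᵘ-cong {ℚᵘ.mkℚᵘ (+ suc j') (q ℕ.+ j' ℕ.* suc q)} {ℚᵘ.mkℚᵘ (+ 1) q}
    (ℚᵘ.*≡* (trans (sym (ℤ.pos-* (suc j') (suc q))) (sym (ℤ.*-identityˡ _)))))

1/1+-anti : ∀ {a c} → a ℕ.≤ c → 1/1+ c ≤ 1/1+ a
1/1+-anti {a} {c} a≤c = toℚᵘ-cancel-≤ (begin
  toℚᵘ (1/1+ c)      ≃⟨ toℚᵘ-fromℚᵘ (ℚᵘ.mkℚᵘ (+ 1) c) ⟩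
  ℚᵘ.mkℚᵘ (+ 1) c    ≤⟨ ℚᵘ.*≤* (ℤ.*-monoˡ-≤-nonNeg (+ 1) (ℤ.+≤+ (ℕ.s≤s a≤c))) ⟩
  ℚᵘ.mkℚᵘ (+ 1) a    ≃⟨ toℚᵘ-fromℚᵘ (ℚᵘ.mkℚᵘ (+ 1) a) ⟨
  toℚᵘ (1/1+ a)      ∎)
  where open ℚᵘ.≤-Reasoning

0<1/1+ : ∀ k → 0ℚ < 1/1+ k
0<1/1+ k = positive⁻¹ (1/1+ k) {{normalize-pos 1 (suc k)}}

harmonic-lower : ∀ b a c → b ℕ.+ a ℕ.≤ suc c → harmonic a + mul b (1/1+ c) ≤ harmonic (b ℕ.+ a)
harmonic-lower zero    a c _   = ≤-reflexive (+-identityʳ (harmonic a))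
harmonic-lower (suc b) a c b+a = begin
  harmonic a + (mul b (1/1+ c) + 1/1+ c)    ≡⟨ +-assoc (harmonic a) (mul b (1/1+ c)) (1/1+ c) ⟨
  harmonic a + mul b (1/1+ c) + 1/1+ c      ≤⟨ +-mono-≤ (harmonic-lower b a c (ℕ.≤-trans (ℕ.n≤1+n _) b+a))
                                                        (1/1+-anti (ℕ.s≤s⁻¹ b+a)) ⟩
  harmonic (b ℕ.+ a) + 1/1+ (b ℕ.+ a)       ∎
  where open ≤-Reasoning

harmonic-upper : ∀ b a → harmonic (b ℕ.+ suc a) ≤ harmonic (suc a) + mul b (1/1+ a)
harmonic-upper zero    a = ≤-reflexive (sym (+-identityʳ (harmonic (suc a))))
harmonic-upper (suc b) a = begin
  harmonic (b ℕ.+ suc a) + 1/1+ (b ℕ.+ suc a)     ≤⟨ +-mono-≤ (harmonic-upper b a)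
    (1/1+-anti (ℕ.≤-trans (ℕ.n≤1+n a) (ℕ.m≤n+m (suc a) b))) ⟩
  harmonic (suc a) + mul b (1/1+ a) + 1/1+ a      ≡⟨ +-assoc (harmonic (suc a)) (mul b (1/1+ a)) (1/1+ a) ⟩
  harmonic (suc a) + (mul b (1/1+ a) + 1/1+ a)    ∎
  where open ≤-Reasoning

block-lower : ∀ j' q → harmonic (suc j' ℕ.* q) + 1/1+ q ≤ harmonic (suc j' ℕ.* suc q)
block-lower j' q = subst₂ (λ x y → harmonic (suc j' ℕ.* q) + x ≤ harmonic y)
  (mul-block j' q) (sym (ℕ.*-suc (suc j') q))
  (harmonic-lower (suc j') (suc j' ℕ.* q) (q ℕ.+ j' ℕ.* suc q) (ℕ.≤-reflexive (sym (ℕ.*-suc (suc j') q))))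

block-upper : ∀ j' q → harmonic (suc j' ℕ.* suc (suc q)) ≤ harmonic (suc j' ℕ.* suc q) + 1/1+ q
block-upper j' q = subst₂ (λ x y → harmonic y ≤ harmonic (suc j' ℕ.* suc q) + x)
  (mul-block j' q) (sym (ℕ.*-suc (suc j') (suc q)))
  (harmonic-upper (suc j') (q ℕ.+ j' ℕ.* suc q))

refine-lower : ∀ j' i r → harmonic (r ℕ.+ i) + harmonic (suc j' ℕ.* i)
                        ≤ harmonic (suc j' ℕ.* (r ℕ.+ i)) + harmonic i
refine-lower j' i zero    = ≤-reflexive (+-comm (harmonic i) (harmonic (suc j' ℕ.* i)))
refine-lower j' i (suc r) = begin
  h + u + hj             ≡⟨ solve 3 (λ h u hj → h :+ u :+ hj := h :+ hj :+ u) refl h u hj ⟩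
  h + hj + u             ≤⟨ +-monoˡ-≤ u (refine-lower j' i r) ⟩
  k + harmonic i + u     ≡⟨ solve 3 (λ k i u → k :+ i :+ u := k :+ u :+ i) refl k (harmonic i) u ⟩
  k + u + harmonic i     ≤⟨ +-monoˡ-≤ (harmonic i) (block-lower j' (r ℕ.+ i)) ⟩
  harmonic (suc j' ℕ.* suc (r ℕ.+ i)) + harmonic i ∎
  where
  open ≤-Reasoning
  open +-*-Solver
  h  = harmonic (r ℕ.+ i)
  u  = 1/1+ (r ℕ.+ i)
  hj = harmonic (suc j' ℕ.* i)
  k  = harmonic (suc j' ℕ.* (r ℕ.+ i))

refine-upper : ∀ j' i' r → harmonic (suc j' ℕ.* suc (r ℕ.+ i')) + harmonic (suc i') + 1/1+ (r ℕ.+ i')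
                         ≤ harmonic (suc (r ℕ.+ i')) + harmonic (suc j' ℕ.* suc i') + 1/1+ i'
refine-upper j' i' zero    = ≤-reflexive (cong (_+ 1/1+ i') (+-comm (harmonic (suc j' ℕ.* suc i')) (harmonic (suc i'))))
refine-upper j' i' (suc r) = begin
  harmonic (suc j' ℕ.* suc (suc q)) + hi + v   ≤⟨ +-monoˡ-≤ v (+-monoˡ-≤ hi (block-upper j' q)) ⟩
  k + u + hi + v                               ≡⟨ solve 4 (λ k u hi v → k :+ u :+ hi :+ v := k :+ hi :+ u :+ v) refl k u hi v ⟩
  k + hi + u + v                               ≤⟨ +-monoˡ-≤ v (refine-upper j' i' r) ⟩
  h + hj + w + v                               ≡⟨ solve 4 (λ h hj w v → h :+ hj :+ w :+ v := h :+ v :+ hj :+ w) refl h hj w v ⟩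
  h + v + hj + w                               ∎
  where
  open ≤-Reasoning
  open +-*-Solver
  q  = r ℕ.+ i'
  h  = harmonic (suc q)
  hi = harmonic (suc i')
  u  = 1/1+ q
  v  = 1/1+ (suc q)
  w  = 1/1+ i'
  hj = harmonic (suc j' ℕ.* suc i')
  k  = harmonic (suc j' ℕ.* suc q)

*-left-swap : ∀ a b c → a ℕ.* (b ℕ.* c) ≡ b ℕ.* (a ℕ.* c)
*-left-swap a b c = trans (sym (ℕ.*-assoc a b c)) (trans (cong (ℕ._* c) (ℕ.*-comm a b)) (ℕ.*-assoc b a c))

cross : ∀ a b c e → a + b ≤ c + e → a - e ≤ c - b
cross a b c e le = subst₂ _≤_
  (solve 3 (λ a b e → (a :+ b) :+ (:- b :- e) := a :- e) refl a b e)
  (solve 3 (λ c b e → (c :+ e) :+ (:- b :- e) := c :- b) refl c b e)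
  (+-monoˡ-≤ (- b - e) le)
  where open +-*-Solver

logSum-refine-≤ : ∀ n j i .{{_ : NonZero n}} .{{_ : NonZero j}} → logSum n i ≤ logSum n (j ℕ.* i)
logSum-refine-≤ n@(suc n') j@(suc j') i = cross (harmonic (n ℕ.* i)) (harmonic (j ℕ.* i)) (harmonic (n ℕ.* (j ℕ.* i))) (harmonic i)
  (subst₂ (λ x y → harmonic x + harmonic (j ℕ.* i) ≤ harmonic y + harmonic i)
    (ℕ.+-comm (n' ℕ.* i) i)
    (trans (cong (j ℕ.*_) (ℕ.+-comm (n' ℕ.* i) i)) (*-left-swap j n i))
    (refine-lower j' i (n' ℕ.* i)))

logSum-refine-≥ : ∀ n j i' .{{_ : NonZero n}} .{{_ : NonZero j}} → logSum n (j ℕ.* suc i') ≤ logSum n (suc i') + 1/1+ i'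
logSum-refine-≥ n@(suc n') j@(suc j') i' = begin
  hnj - hj               ≤⟨ cross hnj hi (hn + w) hj (begin
    hnj + hi             ≡⟨ +-identityʳ (hnj + hi) ⟨
    hnj + hi + 0ℚ        ≤⟨ +-monoʳ-≤ (hnj + hi) (<⇒≤ (0<1/1+ (n' ℕ.* i ℕ.+ i'))) ⟩
    hnj + hi + 1/1+ (n' ℕ.* i ℕ.+ i')
                         ≤⟨ subst₂ (λ x y → harmonic x + hi + 1/1+ (n' ℕ.* i ℕ.+ i') ≤ harmonic y + hj + w)
                              (trans (cong (j ℕ.*_) eq) (*-left-swap j n i)) eq (refine-upper j' i' (n' ℕ.* i)) ⟩
    hn + hj + w          ≡⟨ solve 3 (λ a b c → a :+ b :+ c := a :+ c :+ b) refl hn hj w ⟩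
    hn + w + hj          ∎) ⟩
  hn + w - hi            ≡⟨ solve 3 (λ a b c → a :+ b :- c := a :- c :+ b) refl hn w hi ⟩
  hn - hi + w            ∎
  where
  open ≤-Reasoning
  open +-*-Solver
  i   = suc i'
  hnj = harmonic (n ℕ.* (j ℕ.* i))
  hj  = harmonic (j ℕ.* i)
  hi  = harmonic i
  hn  = harmonic (n ℕ.* i)
  w   = 1/1+ i'
  eq : suc (n' ℕ.* i ℕ.+ i') ≡ n ℕ.* i
  eq = cong suc (ℕ.+-comm (n' ℕ.* i) i')

logSum-close : ∀ n i j' .{{_ : NonZero n}} .{{_ : NonZero i}} → logSum n i - logSum n (suc j') ≤ 1/1+ j'
logSum-close n i j' = begin
  logSum n i - y          ≤⟨ +-monoˡ-≤ (- y) (≤-trans (logSum-refine-≤ n (suc j') i)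
    (≤-trans (≤-reflexive (cong (logSum n) (ℕ.*-comm (suc j') i))) (logSum-refine-≥ n i j'))) ⟩
  y + 1/1+ j' - y         ≡⟨ solve 2 (λ y w → y :+ w :- y := w) refl y (1/1+ j') ⟩
  1/1+ j'                 ∎
  where
  open ≤-Reasoning
  open +-*-Solver
  y = logSum n (suc j')

archimedean : ∀ ε → 0ℚ < ε → ∃[ k ] 1/1+ k < ε
archimedean (mkℚ (+ 0)      q c) (*<* (ℤ.+<+ ()))
archimedean (mkℚ ℤ.-[1+ _ ] q c) (*<* ())
archimedean ε@(mkℚ +[1+ p ] q c) _ = suc q , toℚᵘ-cancel-< (begin-strict
  toℚᵘ (1/1+ suc q)        ≃⟨ toℚᵘ-fromℚᵘ (ℚᵘ.mkℚᵘ (+ 1) (suc q)) ⟩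
  ℚᵘ.mkℚᵘ (+ 1) (suc q)    <⟨ ℚᵘ.*<* (ℤ.+<+ (ℕ.s≤s (ℕ.s≤s (ℕ.≤-trans (ℕ.≤-reflexive (ℕ.+-identityʳ q)) (ℕ.m≤m+n q _))))) ⟩
  toℚᵘ ε                   ∎)
  where open ℚᵘ.≤-Reasoning

∣p-q∣<ε : ∀ p q ε → p - q < ε → q - p < ε → ∣ p - q ∣ < ε
∣p-q∣<ε p q ε p-q<ε q-p<ε with ∣p∣≡p∨∣p∣≡-p (p - q)
... | inj₁ eq = subst (_< ε) (sym eq) p-q<ε
... | inj₂ eq = subst (_< ε) (sym (trans eq (solve 2 (λ p q → :- (p :- q) := q :- p) refl p q))) q-p<ε
  where open +-*-Solver

logSum-cauchy : ∀ n .{{_ : NonZero n}} ε → 0ℚ < ε →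
  ∃[ N ] ∀ i j → N ℕ.≤ i → N ℕ.≤ j → ∣ logSum n i - logSum n j ∣ < ε
logSum-cauchy n ε 0<ε with archimedean ε 0<ε
... | k , small = suc k , λ where
  i@(suc i') j@(suc j') (ℕ.s≤s k≤i') (ℕ.s≤s k≤j') → ∣p-q∣<ε (logSum n i) (logSum n j) ε
    (≤-<-trans (logSum-close n i j') (≤-<-trans (1/1+-anti k≤j') small))
    (≤-<-trans (logSum-close n j i') (≤-<-trans (1/1+-anti k≤i') small))

-- The natural logarithm of a positive integer, log n = ∫₁ⁿ dt/t.
log : (n : ℕ) → .{{NonZero n}} → ℝ
log n = mkℝ (logSum n) (logSum-cauchy n)

{-# OPTIONS --safe #-}
-- Write a, b, e for the exponents of a prime in m, n, z. Division of mn by z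
-- turns e into a + b − e, so ♯ is the point reflection of the exponent box.
-- As d is the product of the factors 1 + e over all primes, the divisor bound
-- holds prime by prime: for a ≤ e = a + s ≤ b = a + s + t, the reflected
-- exponent is a + t and (1 + a + s)(1 + a + t) = (1 + a)(1 + a + s + t) + st.
-- For the logarithms, the Riemann sum of ∫₁ᵃᵇ dt/t splits at b, which gives
-- log (ab) = log a + log b up to one term of the sum.
module Submission where

open import Data.Nat using (ℕ; _*_; _≥_; NonZero)
open import Data.Nat.Divisibility using (_∣_)
open import Data.Product using (_×_; Σ-syntax)
open import Relation.Binary.PropositionalEquality using (_≡_)
open import Defs

open import Data.List.Base using (List; []; _∷_; _++_; length; filter; map; applyUpTo; upTo)
open import Data.List.Membership.Propositional using (_∈_)
open import Data.List.Membership.Propositional.Properties using (∈-map⁺; ∈-map⁻; ∈-++⁺ˡ; ∈-++⁺ʳ; ∈-++⁻; ∈-applyUpTo⁺; ∈-upTo⁻; ∈-filter⁺; ∈-filter⁻)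
open import Data.List.Membership.Propositional.Properties.WithK using (unique∧set⇒bag)
open import Data.List.Properties using (map-cong-local; map-++; filter-++; filter-accept; filter-reject; filter-none; length-++; length-map; upTo-∷ʳ; ++-identityʳ)
open import Data.List.Relation.Binary.BagAndSetEquality using (∼bag⇒↭)
open import Data.List.Relation.Binary.Permutation.Propositional.Properties using (↭-length)
open import Data.List.Relation.Unary.All as All using (All; []; _∷_)
open import Data.List.Relation.Unary.Unique.Propositional using (Unique)
import Data.List.Relation.Unary.Unique.Propositional.Properties as Unique
open import Data.Nat.Base using (zero; suc; _+_; _∸_; _^_; _⊓_; _⊔_; _≤_; _<_; _/_; z≤n; s≤s)
open import Data.Nat.Coprimality using (coprime-divisor)
open import Data.Nat.Divisibility using (_∤_; _∣?_; divides; 0∣⇒≡0; ∣1⇒≡1; ∣⇒≤; ∣-trans; n∣m*n; m*n∣⇒m∣; *-monoʳ-∣; *-cancelˡ-∣)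
open import Data.Nat.DivMod using (m*n/n≡m)
open import Data.Nat.ListAction using (product)
open import Data.Nat.ListAction.Properties using (product-++; ∈⇒∣product)
open import Data.Nat.Primality using (Prime; prime?; ¬prime[0]; ¬prime[1]; euclidsLemma; prime⇒irreducible; prime⇒nonZero)
open import Data.Nat.Primality.Factorisation using (PrimeFactorisation; factorise; factors)
open import Data.Nat.Properties
open import Data.Nat.Tactic.RingSolver using (solve-∀)
open import Data.Product using (_,_; proj₁; proj₂)
import Data.Rational.Base as ℚ
import Data.Rational.Properties as ℚ
open import Data.Rational.Solver using (module +-*-Solver)
open import Data.Sum.Base using (_⊎_; inj₁; inj₂)
open import Function.Base using (_∘_)
open import Function.Bundles using (mk⇔)
open import Relation.Binary.PropositionalEquality using (refl; sym; trans; cong; cong₂; subst; subst₂; module ≡-Reasoning)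
open import Relation.Nullary.Decidable using (yes; no)
open import Relation.Nullary.Negation using (¬_; contradiction)

≡*⇒/≡ : ∀ {a} x y .{{_ : NonZero y}} → a ≡ x * y → a / y ≡ x
≡*⇒/≡ x y refl = m*n/n≡m x y

-- Products over primes

product-map-1 : ∀ {A : Set} (xs : List A) → product (map (λ _ → 1) xs) ≡ 1
product-map-1 []       = refl
product-map-1 (_ ∷ xs) = trans (*-identityˡ _) (product-map-1 xs)

product-map-* : ∀ {A : Set} (f g : A → ℕ) xs →
  product (map (λ x → f x * g x) xs) ≡ product (map f xs) * product (map g xs)
product-map-* f g []       = refl
product-map-* f g (x ∷ xs) = trans (cong (f x * g x *_) (product-map-* f g xs))
  (interchange (f x) (g x) (product (map f xs)) (product (map g xs)))
  where
  interchange : ∀ a b c e → a * b * (c * e) ≡ a * c * (b * e)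
  interchange = solve-∀

product-map-mono-≤ : ∀ {A : Set} {f g : A → ℕ} {xs} → All (λ x → f x ≤ g x) xs →
  product (map f xs) ≤ product (map g xs)
product-map-mono-≤ []          = ≤-refl
product-map-mono-≤ (le ∷ les)  = *-mono-≤ le (product-map-mono-≤ les)

∏ : ℕ → (ℕ → ℕ) → ℕ
∏ N f = product (map f (primesUpTo N))

all-primesUpTo : ∀ {P : ℕ → Set} N → (∀ p → Prime p → p ≤ N → P p) → All P (primesUpTo N)
all-primesUpTo N h = All.tabulate λ {p} p∈ →
  let p∈upTo , pr = ∈-filter⁻ prime? {xs = upTo (suc N)} p∈ in h p pr (≤-pred (∈-upTo⁻ p∈upTo))

∏-cong : ∀ N {f g} → (∀ p → Prime p → p ≤ N → f p ≡ g p) → ∏ N f ≡ ∏ N g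
∏-cong N h = cong product (map-cong-local (all-primesUpTo N h))

∏-mono-≤ : ∀ N {f g} → (∀ p → Prime p → f p ≤ g p) → ∏ N f ≤ ∏ N g
∏-mono-≤ N h = product-map-mono-≤ (all-primesUpTo N λ p pr _ → h p pr)

∏-1 : ∀ N {f} → (∀ p → Prime p → p ≤ N → f p ≡ 1) → ∏ N f ≡ 1
∏-1 N h = trans (∏-cong N h) (product-map-1 (primesUpTo N))

∏-^-+ : ∀ N (e f : ℕ → ℕ) → ∏ N (λ p → p ^ (e p + f p)) ≡ ∏ N (λ p → p ^ e p) * ∏ N (λ p → p ^ f p)
∏-^-+ N e f = trans (∏-cong N λ p _ _ → ^-distribˡ-+-* p (e p) (f p)) (product-map-* _ _ (primesUpTo N))

primesUpTo-suc : ∀ N → primesUpTo (suc N) ≡ primesUpTo N ++ filter prime? (suc N ∷ [])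
primesUpTo-suc N = trans (cong (filter prime?) (sym (upTo-∷ʳ (suc N)))) (filter-++ prime? (upTo (suc N)) (suc N ∷ []))

∏-suc-prime : ∀ N f → Prime (suc N) → ∏ (suc N) f ≡ ∏ N f * f (suc N)
∏-suc-prime N f pr = begin
  product (map f (primesUpTo (suc N)))                ≡⟨ cong (product ∘ map f) (trans (primesUpTo-suc N) (cong (primesUpTo N ++_) (filter-accept prime? pr))) ⟩
  product (map f (primesUpTo N ++ suc N ∷ []))        ≡⟨ cong product (map-++ f (primesUpTo N) (suc N ∷ [])) ⟩
  product (map f (primesUpTo N) ++ f (suc N) ∷ [])    ≡⟨ product-++ (map f (primesUpTo N)) (f (suc N) ∷ []) ⟩
  ∏ N f * (f (suc N) * 1)                             ≡⟨ cong (∏ N f *_) (*-identityʳ _) ⟩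
  ∏ N f * f (suc N)                                   ∎
  where open ≡-Reasoning

∏-suc-¬prime : ∀ N f → ¬ Prime (suc N) → ∏ (suc N) f ≡ ∏ N f
∏-suc-¬prime N f ¬pr = cong (product ∘ map f)
  (trans (primesUpTo-suc N) (trans (cong (primesUpTo N ++_) (filter-reject prime? ¬pr)) (++-identityʳ _)))

-- Lets numbers whose exponents have different support bounds be rewritten over one common range of
-- primes: every added factor is 1.
∏-extend : ∀ k N f → (∀ p → Prime p → N < p → f p ≡ 1) → ∏ (k + N) f ≡ ∏ N f
∏-extend zero    N f h = refl
∏-extend (suc k) N f h with prime? (suc (k + N))
... | yes pr = trans (∏-suc-prime (k + N) f pr)
                 (trans (cong₂ _*_ (∏-extend k N f h) (h _ pr (s≤s (m≤n+m N k)))) (*-identityʳ _))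
... | no ¬pr = trans (∏-suc-¬prime (k + N) f ¬pr) (∏-extend k N f h)

∏-extend-≤ : ∀ {N K} f → N ≤ K → (∀ p → Prime p → N < p → f p ≡ 1) → ∏ K f ≡ ∏ N f
∏-extend-≤ {N} {K} f N≤K h = subst (λ k → ∏ k f ≡ ∏ N f) (m∸n+n≡m N≤K) (∏-extend (K ∸ N) N f h)

∏-single : ∀ N f q → Prime q → q ≤ N → (∀ p → ¬ p ≡ q → f p ≡ 1) → ∏ N f ≡ f q
∏-single zero    f q pr z≤n h = contradiction pr ¬prime[0]
∏-single (suc N) f q pr q≤ h with m≤n⇒m<n∨m≡n q≤
... | inj₂ refl = trans (∏-suc-prime N f pr)
  (trans (cong (_* f q) (∏-1 N λ p _ p≤N → h p (<⇒≢ (s≤s p≤N)))) (*-identityˡ _))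
... | inj₁ (s≤s q≤N) with prime? (suc N)
...   | yes pr′ = trans (∏-suc-prime N f pr′)
  (trans (cong₂ _*_ (∏-single N f q pr q≤N h) (h (suc N) λ { refl → <-irrefl refl q≤N })) (*-identityʳ _))
...   | no ¬pr′ = trans (∏-suc-¬prime N f ¬pr′) (∏-single N f q pr q≤N h)

-- Prime exponents

count : ℕ → List ℕ → ℕ
count p qs = length (filter (p ≟_) qs)

count-∷ : ∀ p q qs → count p (q ∷ qs) ≡ count p (q ∷ []) + count p qs
count-∷ p q qs = trans (cong length (filter-++ (p ≟_) (q ∷ []) qs)) (length-++ (filter (p ≟_) (q ∷ [])))

-- Induction on the list: the head `q` is itself a product over primes, with exponent 1 at `q` and 0
-- elsewhere, and exponents add when the two products are multiplied.
product≡∏^count : ∀ N qs → All Prime qs → All (_≤ N) qs → product qs ≡ ∏ N (λ p → p ^ count p qs)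
product≡∏^count N []       []         []         = sym (∏-1 N λ _ _ _ → refl)
product≡∏^count N (q ∷ qs) (pr ∷ prs) (le ∷ les) = begin
  q * product qs                                                     ≡⟨ cong₂ _*_ (sym single) (product≡∏^count N qs prs les) ⟩
  ∏ N (λ p → p ^ count p (q ∷ [])) * ∏ N (λ p → p ^ count p qs)      ≡⟨ ∏-^-+ N (λ p → count p (q ∷ [])) (λ p → count p qs) ⟨
  ∏ N (λ p → p ^ (count p (q ∷ []) + count p qs))                    ≡⟨ ∏-cong N (λ p _ _ → cong (p ^_) (sym (count-∷ p q qs))) ⟩
  ∏ N (λ p → p ^ count p (q ∷ qs))                                   ∎
  where
  open ≡-Reasoning
  single : ∏ N (λ p → p ^ count p (q ∷ [])) ≡ q
  single = trans
    (∏-single N _ q pr le λ p p≢q → cong (λ xs → p ^ length xs) (filter-reject (p ≟_) p≢q))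
    (trans (cong (λ xs → q ^ length xs) (filter-accept (q ≟_) refl)) (*-identityʳ q))

module _ (n : ℕ) .{{_ : NonZero n}} where
  open PrimeFactorisation (factorise n) using (isFactorisation; factorsPrime)

  private
    factors≤ : All (_≤ n) (factors (factorise n))
    factors≤ = All.tabulate λ q∈ → ∣⇒≤ (subst (_ ∣_) (sym isFactorisation) (∈⇒∣product q∈))

  -- Each prime factor divides `n`, hence is at most `n`. The bound `N` is left free so that several
  -- numbers can share one range.
  ≡∏^exponent : ∀ {N} → n ≤ N → n ≡ ∏ N (λ p → p ^ exponent p n)
  ≡∏^exponent n≤N = trans isFactorisation
    (product≡∏^count _ (factors (factorise n)) factorsPrime (All.map (λ q≤n → ≤-trans q≤n n≤N) factors≤))

  exponent≡0 : ∀ {p} → n < p → exponent p n ≡ 0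
  exponent≡0 {p} n<p = cong length (filter-none (p ≟_) (All.map (λ { q≤n refl → <⇒≱ n<p q≤n }) factors≤))

-- The number of divisors

divisors : ℕ → List ℕ
divisors n = filter (_∣? n) (applyUpTo suc n)

∈-divisors⁺ : ∀ {x} n .{{_ : NonZero n}} → x ∣ n → x ∈ divisors n
∈-divisors⁺ {zero}  (suc n) 0∣n = contradiction (0∣⇒≡0 0∣n) λ ()
∈-divisors⁺ {suc x} n       x∣n = ∈-filter⁺ (_∣? n) (∈-applyUpTo⁺ suc (∣⇒≤ x∣n)) x∣n

∈-divisors⁻ : ∀ {x} n → x ∈ divisors n → x ∣ n
∈-divisors⁻ n x∈ = proj₂ (∈-filter⁻ (_∣? n) {xs = applyUpTo suc n} x∈)

divisors-unique : ∀ n → Unique (divisors n)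
divisors-unique n = Unique.filter⁺ (_∣? n) (Unique.applyUpTo⁺₁ suc n λ i<j _ eq → <⇒≢ i<j (suc-injective eq))

-- Duplicate-free lists with the same elements are permutations of each other. This is how divisors
-- get counted below.
length-unique : ∀ {xs ys : List ℕ} → Unique xs → Unique ys →
  (∀ {x} → x ∈ xs → x ∈ ys) → (∀ {x} → x ∈ ys → x ∈ xs) → length xs ≡ length ys
length-unique u v xs⊆ys ys⊆xs = ↭-length (∼bag⇒↭ (unique∧set⇒bag u v (mk⇔ xs⊆ys ys⊆xs)))

-- Divisors of a prime power times a factor coprime to the prime

module _ {p : ℕ} (pr : Prime p) where
  private instance
    p≢0 : NonZero p
    p≢0 = prime⇒nonZero pr

  prime∤1 : p ∤ 1
  prime∤1 p∣1 = ¬prime[1] (subst Prime (∣1⇒≡1 p∣1) pr)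

  prime∣^⇒∣ : ∀ q k → p ∣ q ^ k → p ∣ q
  prime∣^⇒∣ q zero    p∣1 = contradiction p∣1 prime∤1
  prime∣^⇒∣ q (suc k) p∣  with euclidsLemma q (q ^ k) pr p∣
  ... | inj₁ p∣q  = p∣q
  ... | inj₂ p∣q^ = prime∣^⇒∣ q k p∣q^

  -- A common divisor of `x` and `p` is 1 or `p`, and `p` is excluded, so `x` is coprime to `p`.
  ∤∧∣prime*⇒∣ : ∀ {x r} → p ∤ x → x ∣ p * r → x ∣ r
  ∤∧∣prime*⇒∣ {x} p∤x = coprime-divisor λ { (i∣x , i∣p) → unit i∣x (prime⇒irreducible pr i∣p) }
    where
    unit : ∀ {i} → i ∣ x → i ≡ 1 ⊎ i ≡ p → i ≡ 1
    unit i∣x (inj₁ i≡1)  = i≡1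
    unit i∣x (inj₂ refl) = contradiction i∣x p∤x

  ∣^*⇒∣∨^∣ : ∀ k {x r} → x ∣ p ^ suc k * r → x ∣ p ^ k * r ⊎ p ^ suc k ∣ x
  ∣^*⇒∣∨^∣ k {x} {r} x∣ with p ∣? x
  ... | no p∤x = inj₁ (∤∧∣prime*⇒∣ p∤x (subst (x ∣_) (*-assoc p (p ^ k) r) x∣))
  ∣^*⇒∣∨^∣ zero    {x}     x∣ | yes p∣x = inj₂ (subst (_∣ x) (sym (*-identityʳ p)) p∣x)
  ∣^*⇒∣∨^∣ (suc k) {x} {r} x∣ | yes (divides y x≡yp)
    with refl ← trans x≡yp (*-comm y p)
    with ∣^*⇒∣∨^∣ k (*-cancelˡ-∣ p (subst (p * y ∣_) (*-assoc p (p ^ suc k) r) x∣))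
  ... | inj₁ y∣  = inj₁ (subst (p * y ∣_) (sym (*-assoc p (p ^ k) r)) (*-monoʳ-∣ p y∣))
  ... | inj₂ p^∣ = inj₂ (*-monoʳ-∣ p p^∣)

  module _ {r : ℕ} .{{_ : NonZero r}} (p∤r : p ∤ r) where
    private
      ^≢0 : ∀ k → NonZero (p ^ k)
      ^≢0 k = m^n≢0 p k

      ^*≢0 : ∀ k → NonZero (p ^ k * r)
      ^*≢0 k = m*n≢0 (p ^ k) r {{^≢0 k}}

      -- Keeps the old and the new divisors apart: cancelling `p ^ k` would leave `p ∣ r`.
      ^suc*∤^* : ∀ k {y} → p ^ suc k * y ∤ p ^ k * r
      ^suc*∤^* k {y} div = p∤r (*-cancelˡ-∣ (p ^ k) {{^≢0 k}}
        (subst (_∣ p ^ k * r) (*-comm p (p ^ k)) (m*n∣⇒m∣ (p ^ suc k) y div)))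

    -- The divisors of p ^ suc k * r missing from p ^ k * r are p ^ suc k * y for y ∣ r.
    d-^suc* : ∀ k → d (p ^ suc k * r) ≡ d (p ^ k * r) + d r
    d-^suc* k = trans
      (length-unique (divisors-unique (p ^ suc k * r))
        (Unique.++⁺ (divisors-unique (p ^ k * r))
          (Unique.map⁺ (λ {x} {y} → *-cancelˡ-≡ x y (p ^ suc k) {{^≢0 (suc k)}}) (divisors-unique r))
          disjoint)
        (to ∘ ∈-divisors⁻ (p ^ suc k * r)) (∈-divisors⁺ (p ^ suc k * r) {{^*≢0 (suc k)}} ∘ from))
      (trans (length-++ (divisors (p ^ k * r))) (cong (d (p ^ k * r) +_) (length-map (p ^ suc k *_) (divisors r))))
      where
      new = map (p ^ suc k *_) (divisors r)

      disjoint : ∀ {x} → ¬ (x ∈ divisors (p ^ k * r) × x ∈ new)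
      disjoint (x∈ , x∈new) with ∈-map⁻ (p ^ suc k *_) x∈new
      ... | y , _ , refl = ^suc*∤^* k (∈-divisors⁻ (p ^ k * r) x∈)

      to : ∀ {x} → x ∣ p ^ suc k * r → x ∈ divisors (p ^ k * r) ++ new
      to x∣ with ∣^*⇒∣∨^∣ k x∣
      ... | inj₁ x∣′ = ∈-++⁺ˡ (∈-divisors⁺ (p ^ k * r) {{^*≢0 k}} x∣′)
      ... | inj₂ (divides y x≡) with refl ← trans x≡ (*-comm y (p ^ suc k)) =
        ∈-++⁺ʳ (divisors (p ^ k * r)) (∈-map⁺ (p ^ suc k *_)
          (∈-divisors⁺ r (*-cancelˡ-∣ (p ^ suc k) {{^≢0 (suc k)}} x∣)))

      from : ∀ {x} → x ∈ divisors (p ^ k * r) ++ new → x ∣ p ^ suc k * r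
      from x∈ with ∈-++⁻ (divisors (p ^ k * r)) x∈
      ... | inj₁ x∈′ = ∣-trans (∈-divisors⁻ (p ^ k * r) x∈′)
                         (subst (p ^ k * r ∣_) (sym (*-assoc p (p ^ k) r)) (n∣m*n p))
      ... | inj₂ x∈′ with ∈-map⁻ (p ^ suc k *_) x∈′
      ...   | y , y∈ , refl = *-monoʳ-∣ (p ^ suc k) (∈-divisors⁻ r y∈)

    -- Each further power of `p` contributes `d r` new divisors. This special case of
    -- multiplicativity is enough to compute `d` prime by prime.
    d-^* : ∀ k → d (p ^ k * r) ≡ suc k * d r
    d-^* zero    = trans (cong d (*-identityˡ r)) (sym (*-identityˡ (d r)))
    d-^* (suc k) = trans (d-^suc* k) (trans (cong (_+ d r) (d-^* k)) (+-comm (suc k * d r) (d r)))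

  -- By Euclid's lemma `p` would divide some prime of the range, but all of these are smaller than
  -- `p`.
  prime∤∏ : ∀ N (e : ℕ → ℕ) → N < p → p ∤ ∏ N (λ q → q ^ e q)
  prime∤∏ zero    e _   p∣ = prime∤1 p∣
  prime∤∏ (suc N) e N<p p∣ with prime? (suc N)
  ... | no ¬pr = prime∤∏ N e (<-trans (n<1+n N) N<p) (subst (p ∣_) (∏-suc-¬prime N _ ¬pr) p∣)
  ... | yes pr′ with euclidsLemma (∏ N (λ q → q ^ e q)) (suc N ^ e (suc N)) pr (subst (p ∣_) (∏-suc-prime N _ pr′) p∣)
  ...   | inj₁ p∣∏ = prime∤∏ N e (<-trans (n<1+n N) N<p) p∣∏
  ...   | inj₂ p∣^ = <⇒≱ N<p (∣⇒≤ (prime∣^⇒∣ (suc N) (e (suc N)) p∣^))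

∏^≢0 : ∀ N (e : ℕ → ℕ) → NonZero (∏ N (λ p → p ^ e p))
∏^≢0 zero    e = _
∏^≢0 (suc N) e with prime? (suc N)
... | yes pr = subst NonZero (sym (∏-suc-prime N _ pr))
                 (m*n≢0 _ _ {{∏^≢0 N e}} {{m^n≢0 (suc N) (e (suc N))}})
... | no ¬pr = subst NonZero (sym (∏-suc-¬prime N _ ¬pr)) (∏^≢0 N e)

-- Induction on the range: its largest prime does not divide the product over the smaller ones, so
-- it splits off the factor `suc k`.
d-∏^ : ∀ N (e : ℕ → ℕ) → d (∏ N (λ p → p ^ e p)) ≡ ∏ N (λ p → suc (e p))
d-∏^ zero    e = refl
d-∏^ (suc N) e with prime? (suc N)
... | no ¬pr = trans (cong d (∏-suc-¬prime N _ ¬pr)) (trans (d-∏^ N e) (sym (∏-suc-¬prime N _ ¬pr)))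
... | yes pr = begin
  d (∏ (suc N) (λ p → p ^ e p))      ≡⟨ cong d (trans (∏-suc-prime N _ pr) (*-comm r (suc N ^ k))) ⟩
  d (suc N ^ k * r)                  ≡⟨ d-^* pr {{∏^≢0 N e}} (prime∤∏ pr N e (n<1+n N)) k ⟩
  suc k * d r                        ≡⟨ *-comm (suc k) (d r) ⟩
  d r * suc k                        ≡⟨ cong (_* suc k) (d-∏^ N e) ⟩
  ∏ N (λ p → suc (e p)) * suc k      ≡⟨ ∏-suc-prime N _ pr ⟨
  ∏ (suc N) (λ p → suc (e p))        ∎
  where
  open ≡-Reasoning
  r = ∏ N (λ p → p ^ e p)
  k = e (suc N)

-- Reflection of exponents

-- Reduces symmetric expressions in two exponents to the ordered case, minimum first.
⊓-⊔-symmetric : ∀ (f : ℕ → ℕ → ℕ) → (∀ x y → f x y ≡ f y x) → ∀ a b → f (a ⊓ b) (a ⊔ b) ≡ f a b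
⊓-⊔-symmetric f f-comm a b with ≤-total a b
... | inj₁ a≤b = cong₂ f (m≤n⇒m⊓n≡m a≤b) (m≤n⇒m⊔n≡n a≤b)
... | inj₂ b≤a = trans (cong₂ f (m≥n⇒m⊓n≡n b≤a) (m≥n⇒m⊔n≡m b≤a)) (f-comm b a)

a+[a+s+t]≡a+s+[a+t] : ∀ a s t → a + (a + s + t) ≡ a + s + (a + t)
a+[a+s+t]≡a+s+[a+t] = solve-∀

+≡+⇒suc*suc≤ : ∀ {a b e e′} → a ≤ e → e ≤ b → e + e′ ≡ a + b → suc a * suc b ≤ suc e * suc e′
+≡+⇒suc*suc≤ {a} {b} {e} {e′} a≤e e≤b eq
  with s , refl ← m≤n⇒∃[o]m+o≡n a≤e
  with t , refl ← m≤n⇒∃[o]m+o≡n e≤b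
  -- Cancelling `a + s` in the sum condition forces `e′` to be `a + t`.
  with refl ← +-cancelˡ-≡ (a + s) e′ (a + t) (trans eq (a+[a+s+t]≡a+s+[a+t] a s t))
  = subst (suc a * suc (a + s + t) ≤_) (sym (expand a s t)) (m≤m+n _ (s * t))
  where
  expand : ∀ a s t → suc (a + s) * suc (a + t) ≡ suc a * suc (a + s + t) + s * t
  expand = solve-∀

module _ {a b e : ℕ} (lo : a ⊓ b ≤ e) (hi : e ≤ a ⊔ b) where
  private
    ⊓+⊔ : a ⊓ b + (a ⊔ b) ≡ a + b
    ⊓+⊔ = ⊓-⊔-symmetric _+_ +-comm a b

  -- The truncated subtraction is exact, because `e ≤ a ⊔ b ≤ a + b`.
  +-reflect : e + (a + b ∸ e) ≡ a + b
  +-reflect = m+[n∸m]≡n (≤-trans hi (m⊔n≤m+n a b))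

  -- Since `a + b` is also minimum plus maximum, the reflection exchanges the two ends of the
  -- interval: the upper bound on `e` yields this lower bound, and the lower bound yields
  -- `reflect-hi`.
  reflect-lo : a ⊓ b ≤ a + b ∸ e
  reflect-lo = +-cancelˡ-≤ e _ _ (begin
    e + (a ⊓ b)        ≤⟨ +-monoˡ-≤ (a ⊓ b) hi ⟩
    a ⊔ b + (a ⊓ b)    ≡⟨ +-comm (a ⊔ b) (a ⊓ b) ⟩
    a ⊓ b + (a ⊔ b)      ≡⟨ trans ⊓+⊔ (sym +-reflect) ⟩
    e + (a + b ∸ e)    ∎)
    where open ≤-Reasoning

  reflect-hi : a + b ∸ e ≤ a ⊔ b
  reflect-hi = +-cancelˡ-≤ e _ _ (begin
    e + (a + b ∸ e)    ≡⟨ trans +-reflect (sym ⊓+⊔) ⟩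
    a ⊓ b + (a ⊔ b)      ≤⟨ +-monoˡ-≤ (a ⊔ b) lo ⟩
    e + (a ⊔ b)        ∎)
    where open ≤-Reasoning

  suc*suc≤reflect : suc a * suc b ≤ suc e * suc (a + b ∸ e)
  suc*suc≤reflect = subst (_≤ suc e * suc (a + b ∸ e))
    (⊓-⊔-symmetric (λ x y → suc x * suc y) (λ x y → *-comm (suc x) (suc y)) a b)
    (+≡+⇒suc*suc≤ lo hi (trans +-reflect (sym ⊓+⊔)))

-- Logarithms

-- The sum over `i < k ≤ abi` is cut at `bi`; the upper piece is the Riemann sum for `a` with the
-- finer mesh 1/(bi).
logSum-* : ∀ a b i → logSum (a * b) i ≡ logSum a (b * i) ℚ.+ logSum b i
logSum-* a b i = trans (cong (λ k → harmonic k ℚ.- harmonic i) (*-assoc a b i))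
  (solve 3 (λ x y w → x :- w := (x :- y) :+ (y :- w)) refl (harmonic (a * (b * i))) (harmonic (b * i)) (harmonic i))
  where open +-*-Solver

-- Right-endpoint sums of the decreasing 1/t only grow under refinement, so replacing mesh 1/(bi) by
-- 1/i lowers the first summand.
logSum-*-≥ : ∀ a b i .{{_ : NonZero a}} .{{_ : NonZero b}} → logSum a i ℚ.+ logSum b i ℚ.≤ logSum (a * b) i
logSum-*-≥ a b i = subst (logSum a i ℚ.+ logSum b i ℚ.≤_) (sym (logSum-* a b i))
  (ℚ.+-monoˡ-≤ (logSum b i) (logSum-refine-≤ a b i))

logSum-*-≤ : ∀ a b i .{{_ : NonZero a}} .{{_ : NonZero b}} →
  logSum (a * b) (suc i) ℚ.≤ logSum a (suc i) ℚ.+ logSum b (suc i) ℚ.+ 1/1+ i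
logSum-*-≤ a b i = begin
  logSum (a * b) (suc i)                            ≡⟨ logSum-* a b (suc i) ⟩
  logSum a (b * suc i) ℚ.+ logSum b (suc i)         ≤⟨ ℚ.+-monoˡ-≤ (logSum b (suc i)) (logSum-refine-≥ a b i) ⟩
  logSum a (suc i) ℚ.+ 1/1+ i ℚ.+ logSum b (suc i)  ≡⟨ solve 3 (λ x y w → x :+ w :+ y := x :+ y :+ w) refl (logSum a (suc i)) (logSum b (suc i)) (1/1+ i) ⟩
  logSum a (suc i) ℚ.+ logSum b (suc i) ℚ.+ 1/1+ i  ∎
  where
  open ℚ.≤-Reasoning
  open +-*-Solver

-- The sum for the common product lies between: it is at least the sum for `a` and `b`, and exceeds
-- the sum for `a′` and `b′` by at most one term.
logSum+-close : ∀ a b a′ b′ i .{{_ : NonZero a}} .{{_ : NonZero b}} .{{_ : NonZero a′}} .{{_ : NonZero b′}} → a * b ≡ a′ * b′ →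
  (logSum a (suc i) ℚ.+ logSum b (suc i)) ℚ.- (logSum a′ (suc i) ℚ.+ logSum b′ (suc i)) ℚ.≤ 1/1+ i
logSum+-close a b a′ b′ i ab≡ = begin
  x ℚ.- y               ≤⟨ ℚ.+-monoˡ-≤ (ℚ.- y) (ℚ.≤-trans (logSum-*-≥ a b (suc i))
    (ℚ.≤-trans (ℚ.≤-reflexive (cong (λ k → logSum k (suc i)) ab≡)) (logSum-*-≤ a′ b′ i))) ⟩
  y ℚ.+ 1/1+ i ℚ.- y    ≡⟨ solve 2 (λ y w → y :+ w :- y := w) refl y (1/1+ i) ⟩
  1/1+ i                ∎
  where
  open ℚ.≤-Reasoning
  open +-*-Solver
  x = logSum a (suc i) ℚ.+ logSum b (suc i)
  y = logSum a′ (suc i) ℚ.+ logSum b′ (suc i)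

-- Comparing two factorisations of the same number lets `z * z♯ ≡ m * n` be used directly.
log+log-cong : ∀ a b a′ b′ .{{_ : NonZero a}} .{{_ : NonZero b}} .{{_ : NonZero a′}} .{{_ : NonZero b′}} → a * b ≡ a′ * b′ →
  log a +ᵣ log b ≃ log a′ +ᵣ log b′
log+log-cong a b a′ b′ ab≡ ε 0<ε with archimedean ε 0<ε
-- Starting at `suc k` keeps the index positive and makes the error term at most `1/1+ k`, which is
-- below `ε`.
... | k , small = suc k , λ where
  (suc i) (s≤s k≤i) → ∣p-q∣<ε (logSum a (suc i) ℚ.+ logSum b (suc i)) (logSum a′ (suc i) ℚ.+ logSum b′ (suc i)) ε
    (ℚ.≤-<-trans (logSum+-close a b a′ b′ i ab≡) (ℚ.≤-<-trans (1/1+-anti k≤i) small))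
    (ℚ.≤-<-trans (logSum+-close a′ b′ a b i (sym ab≡)) (ℚ.≤-<-trans (1/1+-anti k≤i) small))

-- The reflected point of the exponent box and its properties

proposition4p1 : (m n : ℕ) .{{_ : NonZero m}} .{{_ : NonZero n}} (z : ℕ) (z∈𝓑 : z ∈𝓑[ m , n ]) →
    let z♯ = sharp m n z z∈𝓑 in
    z ∣ m * n ×
    (Σ[ z♯∈𝓑 ∈ z♯ ∈𝓑[ m , n ] ]
    (sharp m n z♯ z♯∈𝓑 ≡ z
    × log z {{∈𝓑⇒nonZero m n z∈𝓑}} +ᵣ log z♯ {{∈𝓑⇒nonZero m n z♯∈𝓑}} ≃ log m +ᵣ log n
    × d z * d z♯ ≥ d m * d n))
proposition4p1 m n z z∈𝓑@(e , (N , e≡0 , z≡) , bounds) =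
  divides z♯ (trans (sym zz♯≡mn) (*-comm z z♯)) ,
  z♯∈𝓑 ,
  ≡*⇒/≡ z z♯ {{z♯≢0}} (sym zz♯≡mn) ,
  log+log-cong z z♯ m n {{z≢0}} {{z♯≢0}} zz♯≡mn ,
  dm*dn≤
  where
  z♯ = sharp m n z z∈𝓑
  -- One range containing the support of `e` and all prime factors of `m` and `n`.
  K = N ⊔ (m ⊔ n)
  a b e♯ : ℕ → ℕ
  a p = exponent p m
  b p = exponent p n
  e♯ p = a p + b p ∸ e p

  m≤K : m ≤ K
  m≤K = ≤-trans (m≤m⊔n m n) (m≤n⊔m N (m ⊔ n))

  n≤K : n ≤ K
  n≤K = ≤-trans (m≤n⊔m m n) (m≤n⊔m N (m ⊔ n))

  m≡ : m ≡ ∏ K (λ p → p ^ a p)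
  m≡ = ≡∏^exponent m m≤K

  n≡ : n ≡ ∏ K (λ p → p ^ b p)
  n≡ = ≡∏^exponent n n≤K

  z≡∏K : z ≡ ∏ K (λ p → p ^ e p)
  z≡∏K = trans z≡ (sym (∏-extend-≤ _ (m≤m⊔n N (m ⊔ n)) λ p pr N<p → cong (p ^_) (e≡0 p pr N<p)))

  z*∏e♯≡mn : z * ∏ K (λ p → p ^ e♯ p) ≡ m * n
  z*∏e♯≡mn = begin
    z * ∏ K (λ p → p ^ e♯ p)                         ≡⟨ cong (_* ∏ K (λ p → p ^ e♯ p)) z≡∏K ⟩
    ∏ K (λ p → p ^ e p) * ∏ K (λ p → p ^ e♯ p)       ≡⟨ ∏-^-+ K e e♯ ⟨
    ∏ K (λ p → p ^ (e p + e♯ p))                     ≡⟨ ∏-cong K (λ p pr _ → cong (p ^_) (+-reflect (proj₁ (bounds p pr)) (proj₂ (bounds p pr)))) ⟩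
    ∏ K (λ p → p ^ (a p + b p))                      ≡⟨ ∏-^-+ K a b ⟩
    ∏ K (λ p → p ^ a p) * ∏ K (λ p → p ^ b p)        ≡⟨ cong₂ _*_ m≡ n≡ ⟨
    m * n                                            ∎
    where open ≡-Reasoning

  z≢0 : NonZero z
  z≢0 = ∈𝓑⇒nonZero m n z∈𝓑

  -- `sharp` is a truncated quotient; the exact factorisation of `m * n` just obtained identifies
  -- it.
  z♯≡ : z♯ ≡ ∏ K (λ p → p ^ e♯ p)
  z♯≡ = ≡*⇒/≡ _ z {{z≢0}} (trans (sym z*∏e♯≡mn) (*-comm z _))

  zz♯≡mn : z * z♯ ≡ m * n
  zz♯≡mn = trans (cong (z *_) z♯≡) z*∏e♯≡mn

  -- Beyond `K` both `a p` and `b p` vanish, and truncated subtraction from 0 gives 0.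
  e♯≡0 : ∀ p → Prime p → K < p → e♯ p ≡ 0
  e♯≡0 p _ K<p = trans (cong (_∸ e p) (cong₂ _+_ (exponent≡0 m (≤-<-trans m≤K K<p)) (exponent≡0 n (≤-<-trans n≤K K<p)))) (0∸n≡0 (e p))

  z♯∈𝓑 : z♯ ∈𝓑[ m , n ]
  z♯∈𝓑 = e♯ , (K , e♯≡0 , z♯≡) , λ p pr →
    let lo , hi = bounds p pr in reflect-lo lo hi , reflect-hi lo hi

  z♯≢0 : NonZero z♯
  z♯≢0 = ∈𝓑⇒nonZero m n z♯∈𝓑

  d*d≡∏ : ∀ {x y} (f g : ℕ → ℕ) → x ≡ ∏ K (λ p → p ^ f p) → y ≡ ∏ K (λ p → p ^ g p) →
    d x * d y ≡ ∏ K (λ p → suc (f p) * suc (g p))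
  d*d≡∏ f g refl refl = trans (cong₂ _*_ (d-∏^ K f) (d-∏^ K g)) (sym (product-map-* _ _ (primesUpTo K)))

  dm*dn≤ : d m * d n ≤ d z * d z♯
  -- Both sides become products over the same primes, so they can be compared factor by factor.
  dm*dn≤ = subst₂ _≤_ (sym (d*d≡∏ a b m≡ n≡)) (sym (d*d≡∏ e e♯ z≡∏K z♯≡))
    (∏-mono-≤ K λ p pr → let lo , hi = bounds p pr in suc*suc≤reflect lo hi)
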